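{- Let $\mathcal{F}$ be a family of subsets of $[n]$. Assume that there are no 4 different sets $A,B,C,D\in\mathcal{F}$ such that $A\subset B\subset D$, $A\subset C$ and $|B|=|C|$. Then $|\mathcal{F}|\le\Sigma(n,2)$.
   Context: $[n]=\{1,2,\dots,n\}$. For integers $n,k$, $\Sigma(n,k)=\sum_{i=\lceil\frac{n-k}{2}\rceil}^{\lceil\frac{n+k}{2}\rceil-1}\binom{n}{i}$ denotes the sum of the $k$ largest binomial coefficients $\binom{n}{i}$. -}

module Defs where

open import Data.Nat using (ℕ; zero; suc; _+_; _*_; _≤?_; _<?_)
open import Data.Nat.Combinatorics using (_C_)
open import Data.List using (List; map; filter; upTo)
open import Data.Nat.ListAction using (sum)
open import Relation.Nullary.Decidable using (_×-dec_)

-- Σ(n,k) = sum of binom(n,i) over integers i with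
--   ⌈(n-k)/2⌉ ≤ i ≤ ⌈(n+k)/2⌉ - 1.
-- For integer i:  ⌈(n-k)/2⌉ ≤ i  ⇔  n ≤ 2i + k,
--                 i ≤ ⌈(n+k)/2⌉ - 1  ⇔  i < ⌈(n+k)/2⌉  ⇔  2i < n + k.
-- Binomials with i < 0 or i > n vanish, so we sum over i ∈ {0,…,n}.
Σ : ℕ → ℕ → ℕ
Σ n k = sum (map (λ i → n C i)
          (filter (λ i → (n ≤? 2 * i + k) ×-dec (2 * i <? n + k)) (upTo (suc n))))

{-# OPTIONS --safe #-}
module Submission where

-- Weight a maximal chain of subsets of [n] by the sum of n C ∣ Y ∣ over the members Y of F on it.
-- The average weight is length F, so it suffices that, for every X, the chains from X up to [n]
-- have average weight at most K, the sum of the two middle binomial coefficients.  A bound by K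
-- for each single chain fails (three members on a chain can exceed it), but if A ∈ F and A ⊆ X,
-- at most one set covering X is a non-maximal member of F, and then no other set covering X is
-- in F.  This gives, by downward induction from [n], the average weight above such an X with
-- ∣ X ∣ = k: at most n C (k + 1) if n ≤ 2 k + 2, and below that at most
-- n C (c + 1) + (c - k) / (n - k) * (n C c), where c and c + 1 are the two middle levels.

open import Defs
import Algebra.Properties.CommutativeSemigroup as CommutativeSemigroup
open import Data.Bool using (if_then_else_)
import Data.Bool.Properties as Bool
open import Data.Fin.Subset using (Subset; _⊂_; _⊆_; ∣_∣; inside; outside) renaming (⊥ to ∅)
open import Data.Fin.Subset.Properties
  using (∣p∣≤n; ∣⊥∣≡0; out⊂in; s⊂s; ⊆-refl; ⊂-⊆-trans; ⊆-⊂-trans; p⊂q⇒∣p∣<∣q∣; p⊂q⇒p⊆q)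
open import Data.List using (List; []; _∷_; length; map; filter; applyUpTo)
open import Data.List.Properties using (filter-accept)
import Data.List.Membership.DecPropositional as DecMembership
open import Data.List.Membership.Propositional using (_∈_; _∉_)
open import Data.List.Relation.Unary.All.Properties using (All¬⇒¬Any)
open import Data.List.Relation.Unary.AllPairs using (_∷_)
open import Data.List.Relation.Unary.Any using (here; there)
open import Data.List.Relation.Unary.Unique.Propositional using (Unique)
open import Data.Nat
open import Data.Nat.Combinatorics using (_C_; nCk≡n!/k![n-k]!; [n∸k]!k!∣n!; k>n⇒nCk≡0)
open import Data.Nat.DivMod using (m*[n/m]≡n; /-congʳ)
open import Data.Nat.ListAction using (sum)
open import Data.Nat.Properties
open import Data.Nat.Tactic.RingSolver using (solve-∀)
open import Data.Product using (_×_; _,_; ∃; map₂)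
open import Data.Sum using (_⊎_; inj₁; inj₂; [_,_]′)
open import Data.Vec using ([]; _∷_)
import Data.Vec.Properties as Vec
open import Function using (_∘_)
open import Relation.Binary.PropositionalEquality
  using (_≡_; _≢_; refl; sym; trans; cong; cong₂; subst)
open import Relation.Nullary using (¬_; Dec; yes; no; does; contradiction)
open import Relation.Nullary.Decidable using (_×-dec_; _⊎-dec_; ¬?; decidable-stable; toSum; dec-true; dec-false)
open import Relation.Unary using (Pred; Decidable)

open ≤-Reasoning
open CommutativeSemigroup +-commutativeSemigroup using (x∙yz≈y∙xz; interchange)

-- Binomial coefficients

k!j!*nCk≡n! : ∀ {n} k j → k + j ≡ n → k ! * j ! * (n C k) ≡ n !
k!j!*nCk≡n! k j refl = begin-equality
  k ! * j ! * ((k + j) C k)               ≡⟨ cong (k ! * j ! *_) (nCk≡n!/k![n-k]! k≤n) ⟩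
  k ! * j ! * ((k + j) ! / (k ! * (k + j ∸ k) !))
    ≡⟨ cong (k ! * j ! *_) (/-congʳ (cong (λ i → k ! * i !) (m+n∸m≡n k j))) ⟩
  k ! * j ! * ((k + j) ! / (k ! * j !))   ≡⟨ m*[n/m]≡n k!j!∣n! ⟩
  (k + j) !                               ∎
  where
  open import Data.Nat.DivMod using (_/_)
  open import Data.Nat.Divisibility using (_∣_)
  k≤n = m≤m+n k j
  k!j!∣n! : k ! * j ! ∣ (k + j) !
  k!j!∣n! = subst (_∣ (k + j) !)
    (trans (cong (λ i → i ! * k !) (m+n∸m≡n k j)) (*-comm (j !) (k !))) ([n∸k]!k!∣n! k≤n)
  instance
    _ = k !* (k + j ∸ k) !≢0
    _ = k !* j !≢0

C-absorb : ∀ {n} k j → k + j ≡ n → suc k * (n C suc k) ≡ j * (n C k)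
C-absorb {n} k zero eq =
  trans (cong (suc k *_) (k>n⇒nCk≡0 (≤-reflexive (cong suc (trans (sym eq) (+-identityʳ k))))))
    (*-zeroʳ (suc k))
C-absorb {n} k (suc j) eq = *-cancelˡ-≡ _ _ (k ! * j !) (begin-equality
  k ! * j ! * (suc k * (n C suc k))       ≡⟨ rearrangeˡ k (k !) (j !) (n C suc k) ⟩
  suc k ! * j ! * (n C suc k)             ≡⟨ k!j!*nCk≡n! (suc k) j (trans (sym (+-suc k j)) eq) ⟩
  n !                                     ≡⟨ k!j!*nCk≡n! k (suc j) eq ⟨
  k ! * suc j ! * (n C k)                 ≡⟨ rearrangeʳ j (k !) (j !) (n C k) ⟩
  k ! * j ! * (suc j * (n C k))           ∎)
  where
  instance _ = k !* j !≢0
  rearrangeˡ : ∀ k x y z → x * y * (suc k * z) ≡ suc k * x * y * z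
  rearrangeˡ = solve-∀
  rearrangeʳ : ∀ j x y z → x * (suc j * y) * z ≡ x * y * (suc j * z)
  rearrangeʳ = solve-∀

C-increasing : ∀ {n} k j → k + j ≡ n → suc k ≤ j → n C k ≤ n C suc k
C-increasing {n} k j eq k<j = *-cancelˡ-≤ (suc k) (begin
  suc k * (n C k)       ≤⟨ *-monoˡ-≤ (n C k) k<j ⟩
  j * (n C k)           ≡⟨ C-absorb k j eq ⟨
  suc k * (n C suc k)   ∎)

C-decreasing : ∀ {n} k j → k + j ≡ n → j ≤ suc k → n C suc k ≤ n C k
C-decreasing {n} k j eq j≤1+k = *-cancelˡ-≤ (suc k) (begin
  suc k * (n C suc k)   ≡⟨ C-absorb k j eq ⟩
  j * (n C k)           ≤⟨ *-monoˡ-≤ (n C k) j≤1+k ⟩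
  suc k * (n C k)       ∎)

-- Two absorptions reduce the claim to `j * suc j ≤ suc k * suc (suc k)`. Shifting a pair of
-- adjacent levels up by one trades level `k` for level `k + 2`, so this is what makes such pairs
-- decrease.
C-decreasing₂ : ∀ {n} k j → k + suc j ≡ n → j ≤ suc k → n C suc (suc k) ≤ n C k
C-decreasing₂ {n} k j eq j≤1+k = *-cancelˡ-≤ (suc (suc k)) (*-cancelˡ-≤ (suc k) (begin
  suc k * (suc (suc k) * (n C suc (suc k)))
    ≡⟨ cong (suc k *_) (C-absorb (suc k) j (trans (sym (+-suc k j)) eq)) ⟩
  suc k * (j * (n C suc k))             ≡⟨ *-x∙yz≈y∙xz (suc k) j _ ⟩
  j * (suc k * (n C suc k))             ≡⟨ cong (j *_) (C-absorb k (suc j) eq) ⟩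
  j * (suc j * (n C k))                 ≤⟨ *-mono-≤ j≤1+k (*-monoˡ-≤ (n C k) (s≤s j≤1+k)) ⟩
  suc k * (suc (suc k) * (n C k))       ∎))
  where
  open CommutativeSemigroup *-commutativeSemigroup renaming (x∙yz≈y∙xz to *-x∙yz≈y∙xz)

C-pair-decreasing : ∀ {n} c e j → c + e + j ≡ n → n ≤ c + suc (suc c) →
  (n C (c + e)) + (n C suc (c + e)) ≤ (n C c) + (n C suc c)
C-pair-decreasing c zero j eq n≤ rewrite +-identityʳ c = ≤-refl
C-pair-decreasing {n} c (suc e) j eq n≤ rewrite +-suc c e = begin
  (n C suc (c + e)) + (n C suc (suc (c + e)))
    ≤⟨ +-monoʳ-≤ (n C suc (c + e)) (C-decreasing₂ (c + e) j eq′ (s≤s⁻¹ (+-cancelˡ-≤ (c + e) _ _ (begin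
         c + e + suc j             ≡⟨ eq′ ⟩
         n                         ≤⟨ n≤ ⟩
         c + suc (suc c)           ≤⟨ +-mono-≤ (m≤m+n c e) (s≤s (s≤s (m≤m+n c e))) ⟩
         c + e + suc (suc (c + e)) ∎)))) ⟩
  (n C suc (c + e)) + (n C (c + e))
    ≡⟨ +-comm (n C suc (c + e)) _ ⟩
  (n C (c + e)) + (n C suc (c + e))
    ≤⟨ C-pair-decreasing c e (suc j) eq′ n≤ ⟩
  (n C c) + (n C suc c) ∎
  where
  eq′ : c + e + suc j ≡ n
  eq′ = trans (+-suc (c + e) j) eq

-- The covering relation of the Boolean lattice

infix 4 _⋖_

-- The position of the added element is recorded, so that sums over covers and proofs about them
-- recurse along the vector.
data _⋖_ : ∀ {n} → Subset n → Subset n → Set where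
  add  : ∀ {n} {X : Subset n} → outside ∷ X ⋖ inside ∷ X
  keep : ∀ {n} {X Y : Subset n} {b} → X ⋖ Y → b ∷ X ⋖ b ∷ Y

⋖⇒⊂ : ∀ {n} {X Y : Subset n} → X ⋖ Y → X ⊂ Y
⋖⇒⊂ add      = out⊂in ⊆-refl
⋖⇒⊂ (keep p) = s⊂s (⋖⇒⊂ p)

⋖⇒∣∣ : ∀ {n} {X Y : Subset n} → X ⋖ Y → ∣ Y ∣ ≡ suc ∣ X ∣
⋖⇒∣∣ add                      = refl
⋖⇒∣∣ (keep {b = inside} p)    = cong suc (⋖⇒∣∣ p)
⋖⇒∣∣ (keep {b = outside} p)   = ⋖⇒∣∣ p

⋖⇒∣∣+ : ∀ {n m j} {X Y : Subset n} → X ⋖ Y → ∣ X ∣ + suc j ≡ m → ∣ Y ∣ + j ≡ m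
⋖⇒∣∣+ {j = j} {X} p eq = trans (cong (_+ j) (⋖⇒∣∣ p)) (trans (sym (+-suc ∣ X ∣ j)) eq)

all-or-exception : ∀ {n p} {P : Pred (Subset n) p} → Decidable P → ∀ X →
  (∀ {Y} → X ⋖ Y → P Y) ⊎ (∃ λ Y → X ⋖ Y × ¬ P Y)
all-or-exception P? [] = inj₁ λ ()
all-or-exception P? (inside ∷ X) with all-or-exception (P? ∘ (inside ∷_)) X
... | inj₁ all           = inj₁ λ { (keep p) → all p }
... | inj₂ (Y , p , ¬P)  = inj₂ (_ , keep p , ¬P)
all-or-exception P? (outside ∷ X) with P? (inside ∷ X) | all-or-exception (P? ∘ (outside ∷_)) X
... | no ¬P  | _                    = inj₂ (_ , add , ¬P)
... | yes _  | inj₂ (Y , p , ¬P)    = inj₂ (_ , keep p , ¬P)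
... | yes P  | inj₁ all             = inj₁ λ { add → P ; (keep p) → all p }

∑⋖ : ∀ {n} → Subset n → (Subset n → ℕ) → ℕ
∑⋖ []            φ = 0
∑⋖ (inside ∷ X)  φ = ∑⋖ X (φ ∘ (inside ∷_))
∑⋖ (outside ∷ X) φ = φ (inside ∷ X) + ∑⋖ X (φ ∘ (outside ∷_))

∑⋖-cong : ∀ {n} (X : Subset n) {φ ψ} → (∀ {Y} → X ⋖ Y → φ Y ≡ ψ Y) → ∑⋖ X φ ≡ ∑⋖ X ψ
∑⋖-cong []            eq = refl
∑⋖-cong (inside ∷ X)  eq = ∑⋖-cong X (eq ∘ keep)
∑⋖-cong (outside ∷ X) eq = cong₂ _+_ (eq add) (∑⋖-cong X (eq ∘ keep))

∑⋖-*ˡ : ∀ {n} m (X : Subset n) φ → ∑⋖ X (λ Y → m * φ Y) ≡ m * ∑⋖ X φ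
∑⋖-*ˡ m []            φ = sym (*-zeroʳ m)
∑⋖-*ˡ m (inside ∷ X)  φ = ∑⋖-*ˡ m X (φ ∘ (inside ∷_))
∑⋖-*ˡ m (outside ∷ X) φ = trans (cong (m * φ (inside ∷ X) +_) (∑⋖-*ˡ m X (φ ∘ (outside ∷_))))
  (sym (*-distribˡ-+ m (φ (inside ∷ X)) _))

∑⋖-nonzero : ∀ {n} (X : Subset n) φ → ∑⋖ X φ ≢ 0 → ∃ λ Y → X ⋖ Y × φ Y ≢ 0
∑⋖-nonzero [] φ ≢0 = contradiction refl ≢0
∑⋖-nonzero (inside ∷ X) φ ≢0 with ∑⋖-nonzero X (φ ∘ (inside ∷_)) ≢0
... | Y , p , φ≢0 = _ , keep p , φ≢0
∑⋖-nonzero (outside ∷ X) φ ≢0 with φ (inside ∷ X) ≟ 0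
... | no φ≢0 = _ , add , φ≢0
... | yes φ≡0 with ∑⋖-nonzero X (φ ∘ (outside ∷_)) (≢0 ∘ cong₂ _+_ φ≡0)
...   | Y , p , φ≢0 = _ , keep p , φ≢0

-- Here `r` counts the elements outside `X`, each of which yields one cover.
∑⋖-≤ : ∀ {n} (X : Subset n) {φ c} r → ∣ X ∣ + r ≡ n → (∀ {Y} → X ⋖ Y → φ Y ≤ c) → ∑⋖ X φ ≤ r * c
∑⋖-≤ []            r       eq φ≤c = z≤n
∑⋖-≤ (inside ∷ X)  r       eq φ≤c = ∑⋖-≤ X r (suc-injective eq) (φ≤c ∘ keep)
∑⋖-≤ (outside ∷ X) zero    eq φ≤c =
  contradiction (∣p∣≤n X) (<⇒≱ (≤-reflexive (trans (sym eq) (+-identityʳ _))))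
∑⋖-≤ (outside ∷ X) (suc r) eq φ≤c = +-mono-≤ (φ≤c add)
  (∑⋖-≤ X r (suc-injective (trans (sym (+-suc ∣ X ∣ r)) eq)) (φ≤c ∘ keep))

∑⋖-≤-except : ∀ {n} {X Y : Subset n} {φ a b} r → ∣ X ∣ + suc r ≡ n → X ⋖ Y → φ Y ≤ a →
  (∀ {Z} → X ⋖ Z → Z ≢ Y → φ Z ≤ b) → ∑⋖ X φ ≤ a + r * b
∑⋖-≤-except {X = outside ∷ X} r eq add φ≤a φ≤b = +-mono-≤ φ≤a
  (∑⋖-≤ X r (suc-injective (trans (sym (+-suc ∣ X ∣ r)) eq)) (λ p → φ≤b (keep p) λ ()))
∑⋖-≤-except r eq (keep {b = inside} p) φ≤a φ≤b =
  ∑⋖-≤-except r (suc-injective eq) p φ≤a (λ q Z≢Y → φ≤b (keep q) (Z≢Y ∘ Vec.∷-injectiveʳ))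
-- With `r = 0` the head is the only missing element, so the tail has no cover.
∑⋖-≤-except {X = outside ∷ X} zero eq (keep {Y = Y} {outside} p) φ≤a φ≤b =
  contradiction (∣p∣≤n Y) (<⇒≱ (≤-reflexive
    (trans (sym eq) (trans (+-comm ∣ X ∣ 1) (sym (⋖⇒∣∣ p))))))
∑⋖-≤-except {X = outside ∷ X} {φ = φ} {a} {b} (suc r) eq (keep {b = outside} p) φ≤a φ≤b = begin
  φ (inside ∷ X) + ∑⋖ X (φ ∘ (outside ∷_))
    ≤⟨ +-mono-≤ (φ≤b add λ ())
         (∑⋖-≤-except r (suc-injective (trans (sym (+-suc ∣ X ∣ (suc r))) eq)) p φ≤a
           (λ q Z≢Y → φ≤b (keep q) (Z≢Y ∘ Vec.∷-injectiveʳ))) ⟩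
  b + (a + r * b)   ≡⟨ x∙yz≈y∙xz b a (r * b) ⟩
  a + (b + r * b)   ∎

-- Sums over the Boolean lattice

∑ : ∀ {n} → (Subset n → ℕ) → ℕ
∑ {zero}  φ = φ []
∑ {suc n} φ = ∑ (φ ∘ (inside ∷_)) + ∑ (φ ∘ (outside ∷_))

∑-cong : ∀ {n} {φ ψ : Subset n → ℕ} → (∀ X → φ X ≡ ψ X) → ∑ φ ≡ ∑ ψ
∑-cong {zero}  eq = eq []
∑-cong {suc n} eq = cong₂ _+_ (∑-cong (eq ∘ (inside ∷_))) (∑-cong (eq ∘ (outside ∷_)))

∑-mono-≤ : ∀ {n} {φ ψ : Subset n → ℕ} → (∀ X → φ X ≤ ψ X) → ∑ φ ≤ ∑ ψ
∑-mono-≤ {zero}  φ≤ψ = φ≤ψ []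
∑-mono-≤ {suc n} φ≤ψ = +-mono-≤ (∑-mono-≤ (φ≤ψ ∘ (inside ∷_))) (∑-mono-≤ (φ≤ψ ∘ (outside ∷_)))

∑-mono-< : ∀ {n} {φ ψ : Subset n → ℕ} → (∀ X → φ X ≤ ψ X) → ∀ X → φ X < ψ X → ∑ φ < ∑ ψ
∑-mono-< φ≤ψ []            φ<ψ = φ<ψ
∑-mono-< φ≤ψ (inside ∷ X)  φ<ψ =
  +-mono-<-≤ (∑-mono-< (φ≤ψ ∘ (inside ∷_)) X φ<ψ) (∑-mono-≤ (φ≤ψ ∘ (outside ∷_)))
∑-mono-< φ≤ψ (outside ∷ X) φ<ψ =
  +-mono-≤-< (∑-mono-≤ (φ≤ψ ∘ (inside ∷_))) (∑-mono-< (φ≤ψ ∘ (outside ∷_)) X φ<ψ)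

∑-+ : ∀ {n} (φ ψ : Subset n → ℕ) → ∑ (λ X → φ X + ψ X) ≡ ∑ φ + ∑ ψ
∑-+ {zero}  φ ψ = refl
∑-+ {suc n} φ ψ = trans (cong₂ _+_ (∑-+ (φ ∘ (inside ∷_)) _) (∑-+ (φ ∘ (outside ∷_)) _))
  (interchange (∑ (φ ∘ (inside ∷_))) _ _ _)

∑-*ˡ : ∀ {n} m (φ : Subset n → ℕ) → ∑ (λ X → m * φ X) ≡ m * ∑ φ
∑-*ˡ {zero}  m φ = refl
∑-*ˡ {suc n} m φ = trans (cong₂ _+_ (∑-*ˡ m (φ ∘ (inside ∷_))) (∑-*ˡ m (φ ∘ (outside ∷_))))
  (sym (*-distribˡ-+ m (∑ (φ ∘ (inside ∷_))) _))

-- Double counting of the covering pairs: Y covers exactly ∣ Y ∣ sets.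
∑-∑⋖ : ∀ {n} (φ : Subset n → ℕ) → ∑ (λ X → ∑⋖ X φ) ≡ ∑ (λ Y → ∣ Y ∣ * φ Y)
∑-∑⋖ {zero}  φ = refl
∑-∑⋖ {suc n} φ = begin-equality
  ∑ (λ X → ∑⋖ X φᵢ) + ∑ (λ X → φᵢ X + ∑⋖ X φₒ)
    ≡⟨ cong₂ _+_ (∑-∑⋖ φᵢ) (trans (∑-+ φᵢ _) (cong (∑ φᵢ +_) (∑-∑⋖ φₒ))) ⟩
  ∑ (λ Y → ∣ Y ∣ * φᵢ Y) + (∑ φᵢ + ∑ (λ Y → ∣ Y ∣ * φₒ Y))
    ≡⟨ rotate (∑ (λ Y → ∣ Y ∣ * φᵢ Y)) (∑ φᵢ) _ ⟩
  (∑ φᵢ + ∑ (λ Y → ∣ Y ∣ * φᵢ Y)) + ∑ (λ Y → ∣ Y ∣ * φₒ Y)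
    ≡⟨ cong (_+ ∑ (λ Y → ∣ Y ∣ * φₒ Y)) (∑-+ φᵢ _) ⟨
  ∑ (λ Y → φᵢ Y + ∣ Y ∣ * φᵢ Y) + ∑ (λ Y → ∣ Y ∣ * φₒ Y) ∎
  where
  φᵢ = φ ∘ (inside ∷_)
  φₒ = φ ∘ (outside ∷_)
  rotate : ∀ x y z → x + (y + z) ≡ (y + x) + z
  rotate = solve-∀

-- The coefficients differ only at size 0, which `∅` alone has. The intended pair is `k * pred k !`
-- and `k !`, with values 0 and 1 at `k = 0`.
∑-split-∅ : ∀ {n} (φ : Subset n → ℕ) {p q : ℕ → ℕ} → p 0 ≡ 0 → q 0 ≡ 1 →
  (∀ k → p (suc k) ≡ q (suc k)) → ∑ (λ X → q ∣ X ∣ * φ X) ≡ φ ∅ + ∑ (λ X → p ∣ X ∣ * φ X)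
∑-split-∅ {zero}  φ p0 q0 p≡q rewrite p0 | q0 = refl
∑-split-∅ {suc n} φ {p} {q} p0 q0 p≡q = begin-equality
  ∑ (λ X → q (suc ∣ X ∣) * φᵢ X) + ∑ (λ X → q ∣ X ∣ * φₒ X)
    ≡⟨ cong₂ _+_ (∑-cong λ X → cong (_* φᵢ X) (sym (p≡q ∣ X ∣))) (∑-split-∅ φₒ {p} {q} p0 q0 p≡q) ⟩
  ∑ (λ X → p (suc ∣ X ∣) * φᵢ X) + (φₒ ∅ + ∑ (λ X → p ∣ X ∣ * φₒ X))
    ≡⟨ x∙yz≈y∙xz (∑ (λ X → p (suc ∣ X ∣) * φᵢ X)) (φₒ ∅) _ ⟩
  φₒ ∅ + (∑ (λ X → p (suc ∣ X ∣) * φᵢ X) + ∑ (λ X → p ∣ X ∣ * φₒ X)) ∎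
  where
  φᵢ = φ ∘ (inside ∷_)
  φₒ = φ ∘ (outside ∷_)

-- Chain weights

module Weight {n} (F : List (Subset n)) where

  _∈F? : (X : Subset n) → Dec (X ∈ F)
  X ∈F? = DecMembership._∈?_ (Vec.≡-dec Bool._≟_) X F

  χ : Subset n → ℕ
  χ X = if does (X ∈F?) then 1 else 0

  χ-∈ : ∀ {X} → X ∈ F → χ X ≡ 1
  χ-∈ {X} X∈F rewrite dec-true (X ∈F?) X∈F = refl

  χ-∉ : ∀ {X} → X ∉ F → χ X ≡ 0
  χ-∉ {X} X∉F rewrite dec-false (X ∈F?) X∉F = refl

  χ≤1 : ∀ X → χ X ≤ 1
  χ≤1 X with does (X ∈F?)
  ... | inside  = ≤-refl
  ... | outside = z≤n

  -- For j = n - ∣ X ∣, weight j X is the sum, over the j ! maximal chains from X to [n], of the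
  -- total of n C ∣ Y ∣ over the members Y of F on the chain; above j X leaves out Y = X.
  weight above : ℕ → Subset n → ℕ
  weight j X = j ! * (n C ∣ X ∣) * χ X + above j X
  above zero    X = 0
  above (suc j) X = ∑⋖ X (weight j)

  weight-∈ : ∀ j {X} → X ∈ F → weight j X ≡ j ! * (n C ∣ X ∣) + above j X
  weight-∈ j {X} X∈F rewrite χ-∈ X∈F = cong (_+ above j X) (*-identityʳ _)

  weight-∉ : ∀ j {X} → X ∉ F → weight j X ≡ above j X
  weight-∉ j {X} X∉F rewrite χ-∉ X∉F = cong (_+ above j X) (*-zeroʳ (j ! * (n C ∣ X ∣)))

  -- A nonzero sum has a nonzero summand, which is followed upwards until a member of `F` appears.
  -- This lets the decidable test `above j X ≡ 0` stand in for maximality.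
  above-nonzero : ∀ j X → above j X ≢ 0 → ∃ λ D → D ∈ F × X ⊂ D
  weight-nonzero : ∀ j X → Dec (X ∈ F) → weight j X ≢ 0 → ∃ λ D → D ∈ F × X ⊆ D

  above-nonzero zero    X ≢0 = contradiction refl ≢0
  above-nonzero (suc j) X ≢0 =
    let Y , X⋖Y , wY≢0 = ∑⋖-nonzero X (weight j) ≢0
        D , D∈F , Y⊆D  = weight-nonzero j Y (Y ∈F?) wY≢0
    in  D , D∈F , ⊂-⊆-trans (⋖⇒⊂ X⋖Y) Y⊆D

  weight-nonzero j X (yes X∈F) ≢0 = X , X∈F , ⊆-refl
  weight-nonzero j X (no  X∉F) ≢0 =
    map₂ (map₂ p⊂q⇒p⊆q) (above-nonzero j X (≢0 ∘ trans (weight-∉ j X∉F)))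

  total : Subset n → ℕ
  total X = weight (n ∸ ∣ X ∣) X

  -- The index `j` is determined by `X`. Eliminating it makes the summand a function of the cover
  -- alone, as double counting requires.
  above-total : ∀ j X → ∣ X ∣ + j ≡ n → above j X ≡ ∑⋖ X total
  above-total zero    X eq = sym (n≤0⇒n≡0 (∑⋖-≤ X {c = 0} 0 eq λ {Y} X⋖Y →
    contradiction (∣p∣≤n Y) (<⇒≱ (begin-strict
      n           ≡⟨ trans (sym eq) (+-identityʳ ∣ X ∣) ⟩
      ∣ X ∣       <⟨ p⊂q⇒∣p∣<∣q∣ (⋖⇒⊂ X⋖Y) ⟩
      ∣ Y ∣       ∎))))
  above-total (suc j) X eq = ∑⋖-cong X λ {Y} X⋖Y → cong (λ i → weight i Y)
    (trans (sym (m+n∸m≡n ∣ Y ∣ j)) (cong (_∸ ∣ Y ∣) (⋖⇒∣∣+ X⋖Y eq)))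

  -- Since `k ! * j !` maximal chains pass through `X`, a member of any size carries total weight
  -- `n !`. The factor `k !` is moved to the covers as `pred ∣ Y ∣ !`, which depends on `Y` only.
  ∣X∣!*total : ∀ X →
    ∣ X ∣ ! * total X ≡ n ! * χ X + ∑⋖ X (λ Y → pred ∣ Y ∣ ! * total Y)
  ∣X∣!*total X = begin-equality
    k ! * (j ! * (n C k) * χ X + above j X)
      ≡⟨ distribute (k !) (j !) (n C k) (χ X) (above j X) ⟩
    k ! * j ! * (n C k) * χ X + k ! * above j X
      ≡⟨ cong₂ (λ u v → u * χ X + k ! * v) (k!j!*nCk≡n! k j k+j≡n) (above-total j X k+j≡n) ⟩
    n ! * χ X + k ! * ∑⋖ X total
      ≡⟨ cong (n ! * χ X +_) (∑⋖-*ˡ (k !) X total) ⟨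
    n ! * χ X + ∑⋖ X (λ Y → k ! * total Y)
      ≡⟨ cong (n ! * χ X +_) (∑⋖-cong X λ {Y} X⋖Y →
           cong (λ i → pred i ! * total Y) (sym (⋖⇒∣∣ X⋖Y))) ⟩
    n ! * χ X + ∑⋖ X (λ Y → pred ∣ Y ∣ ! * total Y) ∎
    where
    k = ∣ X ∣
    j = n ∸ ∣ X ∣
    k+j≡n : k + j ≡ n
    k+j≡n = m+[n∸m]≡n (∣p∣≤n X)
    distribute : ∀ a b c d e → a * (b * c * d + e) ≡ a * b * c * d + a * e
    distribute = solve-∀

  -- The factor ∣ X ∣ ! (the number of maximal chains below X) makes the sum over X telescope.
  n!*∑χ≡total∅ : n ! * ∑ χ ≡ total ∅
  n!*∑χ≡total∅ = +-cancelʳ-≡ rest _ _ (begin-equality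
    n ! * ∑ χ + rest
      ≡⟨ cong₂ _+_ (sym (∑-*ˡ (n !) χ)) (trans (∑-cong λ Y → *-assoc ∣ Y ∣ (pred ∣ Y ∣ !) (total Y)) (sym (∑-∑⋖ lower))) ⟩
    ∑ (λ X → n ! * χ X) + ∑ (λ X → ∑⋖ X lower)
      ≡⟨ ∑-+ (λ X → n ! * χ X) (λ X → ∑⋖ X lower) ⟨
    ∑ (λ X → n ! * χ X + ∑⋖ X lower)
      ≡⟨ ∑-cong ∣X∣!*total ⟨
    ∑ (λ X → ∣ X ∣ ! * total X)
      ≡⟨ ∑-split-∅ total {λ k → k * pred k !} {_!} refl refl (λ _ → refl) ⟩
    total ∅ + rest ∎)
    where
    lower : Subset n → ℕ
    lower Y = pred ∣ Y ∣ ! * total Y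
    rest = ∑ (λ Y → ∣ Y ∣ * pred ∣ Y ∣ ! * total Y)

-- Putting `A` in front lowers no indicator and raises the one at `A`, because uniqueness keeps `A`
-- out of the tail.
length≤∑χ : ∀ {n} {F : List (Subset n)} → Unique F → length F ≤ ∑ (Weight.χ F)
length≤∑χ {F = []} _ = z≤n
length≤∑χ {n} {A ∷ F} (A≢ ∷ unique) = ≤-<-trans (length≤∑χ unique) (∑-mono-< χ≤ A χ<)
  where
  module F = Weight F
  module A∷F = Weight (A ∷ F)
  χ≤′ : ∀ X → Dec (X ∈ F) → F.χ X ≤ A∷F.χ X
  χ≤′ X (yes X∈F) = ≤-reflexive (trans (F.χ-∈ X∈F) (sym (A∷F.χ-∈ (there X∈F))))
  χ≤′ X (no  X∉F) = subst (_≤ A∷F.χ X) (sym (F.χ-∉ X∉F)) z≤n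
  χ≤ : ∀ X → F.χ X ≤ A∷F.χ X
  χ≤ X = χ≤′ X (X F.∈F?)
  χ< : F.χ A < A∷F.χ A
  χ< = ≤-reflexive (trans (cong suc (F.χ-∉ (All¬⇒¬Any A≢))) (sym (A∷F.χ-∈ (here refl))))

-- Bounding the chain weights

Free : ∀ {n} → List (Subset n) → Set
Free F = ∀ A B C D → A ∈ F → B ∈ F → C ∈ F → D ∈ F →
  ¬ (A ⊂ B × B ⊂ D × A ⊂ C × ∣ B ∣ ≡ ∣ C ∣ × ¬ B ≡ C × ¬ C ≡ D)

module Bounds {n} (F : List (Subset n)) (free : Free F) where

  open Weight F

  -- The nonzero sum supplies a member `D` strictly above `Y`. As `Y` and `Z` lie on one level above
  -- `A`, having `Z` in `F` would complete the forbidden configuration.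
  only-nonmaximal : ∀ {A X Y Z} j → A ∈ F → A ⊆ X → X ⋖ Y → X ⋖ Z →
    Y ∈ F → above j Y ≢ 0 → Z ≢ Y → Z ∉ F
  only-nonmaximal {A} {X} {Y} {Z} j A∈F A⊆X X⋖Y X⋖Z Y∈F ≢0 Z≢Y Z∈F =
    let D , D∈F , Y⊂D = above-nonzero j Y ≢0
        ∣Y∣≡∣Z∣ = trans (⋖⇒∣∣ X⋖Y) (sym (⋖⇒∣∣ X⋖Z))
    in  free A Y Z D A∈F Y∈F Z∈F D∈F
          ( ⊆-⊂-trans A⊆X (⋖⇒⊂ X⋖Y) , Y⊂D , ⊆-⊂-trans A⊆X (⋖⇒⊂ X⋖Z) , ∣Y∣≡∣Z∣ , Z≢Y ∘ sym
          -- `D` is larger than `Y`, hence larger than `Z`.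
          , λ Z≡D → <⇒≢ (p⊂q⇒∣p∣<∣q∣ Y⊂D) (trans ∣Y∣≡∣Z∣ (cong ∣_∣ Z≡D)))

  -- Either every member of F covering X is maximal in F, or exactly one set covering X
  -- lies in F; the two alternatives bound above X accordingly.
  above-step : ∀ {A X a b c} j → A ∈ F → A ⊆ X → ∣ X ∣ + suc j ≡ n →
    (∀ {Y} → X ⋖ Y → Y ∈ F → weight j Y ≤ a) → (∀ {Y} → X ⋖ Y → above j Y ≤ b) →
    b ≤ c → j ! * (n C suc ∣ X ∣) ≤ c →
    (above (suc j) X ≤ suc j * c) ⊎ (above (suc j) X ≤ a + j * b)
  above-step {A} {X} {a} {b} {c} j A∈F A⊆X eq wY≤a aY≤b b≤c w≤c
    with all-or-exception (λ Y → ¬? (Y ∈F?) ⊎-dec (above j Y ≟ 0)) X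
  -- Each cover contributes its own term or what lies above it, never both, so `c` only has to
  -- dominate each of the two.
  ... | inj₁ all = inj₁ (∑⋖-≤ X (suc j) eq λ X⋖Y → bound X⋖Y (all X⋖Y))
    where
    bound : ∀ {Y} → X ⋖ Y → Y ∉ F ⊎ above j Y ≡ 0 → weight j Y ≤ c
    bound {Y} X⋖Y (inj₁ Y∉F) = begin
      weight j Y    ≡⟨ weight-∉ j Y∉F ⟩
      above j Y     ≤⟨ aY≤b X⋖Y ⟩
      b             ≤⟨ b≤c ⟩
      c             ∎
    bound {Y} X⋖Y (inj₂ a≡0) = begin
      j ! * (n C ∣ Y ∣) * χ Y + above j Y
        ≡⟨ cong (j ! * (n C ∣ Y ∣) * χ Y +_) a≡0 ⟩
      j ! * (n C ∣ Y ∣) * χ Y + 0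
        ≡⟨ +-identityʳ _ ⟩
      j ! * (n C ∣ Y ∣) * χ Y
        ≤⟨ *-monoʳ-≤ (j ! * (n C ∣ Y ∣)) (χ≤1 Y) ⟩
      j ! * (n C ∣ Y ∣) * 1
        ≡⟨ *-identityʳ _ ⟩
      j ! * (n C ∣ Y ∣)
        ≡⟨ cong (λ k → j ! * (n C k)) (⋖⇒∣∣ X⋖Y) ⟩
      j ! * (n C suc ∣ X ∣)
        ≤⟨ w≤c ⟩
      c ∎
  ... | inj₂ (Y , X⋖Y , bad) =
    -- The exception `Y` is a member with something above it, so the other covers are outside `F`
    -- and keep only their `above` part.
    inj₂ (∑⋖-≤-except j eq X⋖Y (wY≤a X⋖Y Y∈F) λ {Z} X⋖Z Z≢Y →
      subst (_≤ b) (sym (weight-∉ j (only-nonmaximal j A∈F A⊆X X⋖Y X⋖Z Y∈F (bad ∘ inj₂) Z≢Y)))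
        (aY≤b X⋖Z))
    where
    Y∈F : Y ∈ F
    Y∈F = decidable-stable (Y ∈F?) (bad ∘ inj₁)

  -- On average this is the value obtained when all covers are maximal members. The induction goes
  -- up the lattice; one non-maximal cover adds its own term but removes those of all the others.
  above-high : ∀ {A X} j → A ∈ F → A ⊆ X → ∣ X ∣ + j ≡ n → j ≤ suc (suc ∣ X ∣) →
    above j X ≤ j ! * (n C suc ∣ X ∣)
  above-high         zero    A∈F A⊆X eq j≤ = z≤n
  above-high {A} {X} (suc j) A∈F A⊆X eq j≤ =
    combine (above-step {a = j ! * (n C k) + j ! * (n C suc k)} j A∈F A⊆X eq weight≤ above≤
      (*-monoʳ-≤ (j !) (C-decreasing k j k+j≡n (<⇒≤ j≤))) ≤-refl)
    where
    k = suc ∣ X ∣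
    k+j≡n : k + j ≡ n
    k+j≡n = trans (sym (+-suc ∣ X ∣ j)) eq
    above≤ : ∀ {Y} → X ⋖ Y → above j Y ≤ j ! * (n C suc k)
    above≤ {Y} X⋖Y = subst (λ i → above j Y ≤ j ! * (n C suc i)) (⋖⇒∣∣ X⋖Y)
      (above-high j A∈F (p⊂q⇒p⊆q (⊆-⊂-trans A⊆X (⋖⇒⊂ X⋖Y))) (⋖⇒∣∣+ X⋖Y eq)
        (≤-trans (<⇒≤ j≤) (s≤s (≤-trans (≤-reflexive (sym (⋖⇒∣∣ X⋖Y))) (n≤1+n ∣ Y ∣)))))
    weight≤ : ∀ {Y} → X ⋖ Y → Y ∈ F → weight j Y ≤ j ! * (n C k) + j ! * (n C suc k)
    weight≤ {Y} X⋖Y Y∈F = begin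
      weight j Y
        ≡⟨ weight-∈ j Y∈F ⟩
      j ! * (n C ∣ Y ∣) + above j Y
        ≤⟨ +-mono-≤ (≤-reflexive (cong (λ i → j ! * (n C i)) (⋖⇒∣∣ X⋖Y))) (above≤ X⋖Y) ⟩
      j ! * (n C k) + j ! * (n C suc k) ∎
    collect : ∀ j x y z → x * y + x * z + j * (x * z) ≡ x * (y + suc j * z)
    collect = solve-∀
    collect′ : ∀ j x y → x * (y + j * y) ≡ (x + j * x) * y
    collect′ = solve-∀
    combine : _ → above (suc j) X ≤ suc j ! * (n C k)
    combine (inj₁ above≤) = ≤-trans above≤ (≤-reflexive (sym (*-assoc (suc j) (j !) (n C k))))
    combine (inj₂ above≤) = begin
      above (suc j) X
        ≤⟨ above≤ ⟩
      j ! * (n C k) + j ! * (n C suc k) + j * (j ! * (n C suc k))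
        ≡⟨ collect j (j !) (n C k) (n C suc k) ⟩
      j ! * ((n C k) + suc j * (n C suc k))
        -- The level condition enters as `suc j ≤ suc k`; it is just enough for absorption to turn
        -- the sum into `suc j` copies of `n C k`.
        ≤⟨ *-monoʳ-≤ (j !) (+-monoʳ-≤ (n C k) (*-monoˡ-≤ (n C suc k) j≤)) ⟩
      j ! * ((n C k) + suc k * (n C suc k))
        ≡⟨ cong (λ x → j ! * ((n C k) + x)) (C-absorb k j k+j≡n) ⟩
      j ! * ((n C k) + j * (n C k))
        ≡⟨ collect′ j (j !) (n C k) ⟩
      suc j ! * (n C k) ∎

  weight-high : ∀ {X} j → X ∈ F → ∣ X ∣ + j ≡ n → j ≤ suc (suc ∣ X ∣) →
    weight j X ≤ j ! * ((n C ∣ X ∣) + (n C suc ∣ X ∣))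
  weight-high {X} j X∈F eq j≤ = begin
    weight j X
      ≡⟨ weight-∈ j X∈F ⟩
    j ! * (n C ∣ X ∣) + above j X
      ≤⟨ +-monoʳ-≤ (j ! * (n C ∣ X ∣)) (above-high j X∈F ⊆-refl eq j≤) ⟩
    j ! * (n C ∣ X ∣) + j ! * (n C suc ∣ X ∣)
      ≡⟨ *-distribˡ-+ (j !) (n C ∣ X ∣) _ ⟨
    j ! * ((n C ∣ X ∣) + (n C suc ∣ X ∣)) ∎

  -- Here `n` is `2 c + 1` if `d = c` and `2 c + 2` if `d = suc c`, so `c` and `c + 1` carry the two
  -- largest binomial coefficients. `top` is the K of the overview.
  module Middle (c d : ℕ) (c+1+d≡n : c + suc d ≡ n) (c≤d : c ≤ d) (d≤1+c : d ≤ suc c) where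

    top : ℕ
    top = (n C c) + (n C suc c)

    -- The climb is one level at a time. Each step starts at some `k ≤ c`, where `c ≤ d` leaves at
    -- least `suc k` elements outside.
    C≤C-upper : ∀ k i → k + i ≡ suc c → n C k ≤ n C suc c
    C≤C-upper k zero    eq = ≤-reflexive (cong (n C_) (trans (sym (+-identityʳ k)) eq))
    C≤C-upper k (suc i) eq = ≤-trans
      (C-increasing k (i + suc d) k+j≡n (≤-trans k≤c (≤-trans (s≤s c≤d) (m≤n+m (suc d) i))))
      (C≤C-upper (suc k) i (trans (sym (+-suc k i)) eq))
      where
      k+i≡c : k + i ≡ c
      k+i≡c = suc-injective (trans (sym (+-suc k i)) eq)
      k≤c : suc k ≤ suc c
      k≤c = s≤s (subst (k ≤_) k+i≡c (m≤m+n k i))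
      k+j≡n : k + (i + suc d) ≡ n
      k+j≡n = trans (sym (+-assoc k i (suc d))) (trans (cong (_+ suc d) k+i≡c) c+1+d≡n)

    level-eq : ∀ k i → k + i ≡ c → k + suc (d + i) ≡ n
    level-eq k i eq = begin-equality
      k + suc (d + i)   ≡⟨ rearrange k d i ⟩
      k + i + suc d     ≡⟨ cong (_+ suc d) eq ⟩
      c + suc d         ≡⟨ c+1+d≡n ⟩
      n                 ∎
      where
      rearrange : ∀ k d i → k + suc (d + i) ≡ k + i + suc d
      rearrange = solve-∀

    -- (n - k) * (n C k) = n * ((n - 1) C k), increasing in k ≤ c.
    scaled-C-increasing : ∀ k i → k + i ≡ c → suc (d + i) * (n C k) ≤ suc d * (n C c)
    scaled-C-increasing k zero    eq = ≤-reflexive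
      (cong₂ (λ x y → suc x * (n C y)) (+-identityʳ d) (trans (sym (+-identityʳ k)) eq))
    scaled-C-increasing k (suc i) eq = begin
      suc (d + suc i) * (n C k)     ≡⟨ C-absorb k (suc (d + suc i)) (level-eq k (suc i) eq) ⟨
      suc k * (n C suc k)           ≤⟨ *-monoˡ-≤ (n C suc k) (≤-trans 1+k≤c (≤-trans c≤d (≤-trans (m≤m+n d i) (n≤1+n _)))) ⟩
      suc (d + i) * (n C suc k)     ≤⟨ scaled-C-increasing (suc k) i eq′ ⟩
      suc d * (n C c)               ∎
      where
      eq′ : suc k + i ≡ c
      eq′ = trans (sym (+-suc k i)) eq
      1+k≤c : suc k ≤ c
      1+k≤c = subst (suc k ≤_) eq′ (m≤m+n (suc k) i)

    -- With `i = c - ∣ X ∣` and `suc j = n - ∣ X ∣`, the coefficient of `n C c` on average is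
    -- `u i = i / (n - ∣ X ∣)`. It solves `(n - ∣ X ∣) * u i = 1 + (n - ∣ X ∣ - 1) * u (i -
    -- 1)` with `u 0 =
    -- 0`: one exceptional cover is charged `top`, the others the previous bound. Level `c` falls under `above-high`.
    above-low : ∀ i j {A X} → A ∈ F → A ⊆ X → ∣ X ∣ + i ≡ c → j ≡ d + i →
      above (suc j) X ≤ suc j ! * (n C suc c) + j ! * (i * (n C c))
    weight-low : ∀ i j {X} → X ∈ F → ∣ X ∣ + i ≡ c → j ≡ d + i → weight (suc j) X ≤ suc j ! * top

    above-low zero j {A} {X} A∈F A⊆X eq refl = begin
      above (suc j) X
        ≤⟨ above-high (suc j) A∈F A⊆X (level-eq ∣ X ∣ 0 eq) (s≤s (begin
             d + 0     ≡⟨ +-identityʳ d ⟩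
             d         ≤⟨ d≤1+c ⟩
             suc c     ≡⟨ cong suc ∣X∣≡c ⟨
             suc ∣ X ∣ ∎)) ⟩
      suc j ! * (n C suc ∣ X ∣)
        ≡⟨ cong (λ k → suc j ! * (n C suc k)) ∣X∣≡c ⟩
      suc j ! * (n C suc c)
        ≤⟨ m≤m+n _ _ ⟩
      suc j ! * (n C suc c) + j ! * (0 * (n C c)) ∎
      where
      ∣X∣≡c : ∣ X ∣ ≡ c
      ∣X∣≡c = trans (sym (+-identityʳ ∣ X ∣)) eq
    above-low (suc i) zero    A∈F A⊆X eq j≡ = contradiction (trans j≡ (+-suc d i)) λ ()
    above-low (suc i) (suc j) {A} {X} A∈F A⊆X eq j≡ =
      combine (above-step (suc j) A∈F A⊆X
        (subst (λ i → ∣ X ∣ + suc i ≡ n) (sym j≡) (level-eq ∣ X ∣ (suc i) eq))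
        (λ X⋖Y Y∈F → weight-low i j Y∈F (⋖⇒∣∣+ X⋖Y eq) j≡′)
        (λ X⋖Y → above-low i j A∈F (p⊂q⇒p⊆q (⊆-⊂-trans A⊆X (⋖⇒⊂ X⋖Y))) (⋖⇒∣∣+ X⋖Y eq) j≡′)
        -- The bound `b` on `above` also dominates a single member's term, so it serves as `c` in
        -- `above-step`.
        ≤-refl
        (≤-trans (*-monoʳ-≤ (suc j !) (C≤C-upper (suc ∣ X ∣) (suc i) (cong suc eq))) (m≤m+n _ _)))
      where
      j≡′ : j ≡ d + i
      j≡′ = suc-injective (trans j≡ (+-suc d i))
      b = suc j ! * (n C suc c) + j ! * (i * (n C c))
      expand : ∀ j i f x y → suc (suc j) * ((suc j * f) * x + f * (i * y)) ≡
        suc (suc j) * (suc j * f) * x + f * ((i + suc j * i) * y)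
      expand = solve-∀
      contract : ∀ j i f y → f * ((suc j + suc j * i) * y) ≡ suc j * f * (suc i * y)
      contract = solve-∀
      exact : ∀ j i f x y → suc j * f * (y + x) + suc j * (suc j * f * x + f * (i * y)) ≡
        suc (suc j) * (suc j * f) * x + suc j * f * (suc i * y)
      exact = solve-∀
      combine : (above (suc (suc j)) X ≤ suc (suc j) * b) ⊎
                (above (suc (suc j)) X ≤ suc j ! * top + suc j * b) →
        above (suc (suc j)) X ≤ suc (suc j) ! * (n C suc c) + suc j ! * (suc i * (n C c))
      combine (inj₁ above≤) = begin
        above (suc (suc j)) X
          ≤⟨ above≤ ⟩
        suc (suc j) * b
          ≡⟨ expand j i (j !) (n C suc c) (n C c) ⟩
        suc (suc j) ! * (n C suc c) + j ! * ((i + suc j * i) * (n C c))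
          -- This is `i / (j + 1) ≤ (i + 1) / (j + 2)`, which holds because `i ≤ j + 1`.
          ≤⟨ +-monoʳ-≤ (suc (suc j) ! * (n C suc c)) (*-monoʳ-≤ (j !) (*-monoˡ-≤ (n C c)
               (+-monoˡ-≤ (suc j * i) (≤-trans (m≤n+m i d) (≤-trans (≤-reflexive (sym j≡′)) (n≤1+n j)))))) ⟩
        suc (suc j) ! * (n C suc c) + j ! * ((suc j + suc j * i) * (n C c))
          ≡⟨ cong (suc (suc j) ! * (n C suc c) +_) (contract j i (j !) (n C c)) ⟩
        suc (suc j) ! * (n C suc c) + suc j ! * (suc i * (n C c)) ∎
      combine (inj₂ above≤) = ≤-trans above≤ (≤-reflexive (exact j i (j !) (n C suc c) (n C c)))

    weight-low i j {X} X∈F eq refl = begin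
      weight (suc j) X
        ≡⟨ weight-∈ (suc j) X∈F ⟩
      suc j ! * (n C ∣ X ∣) + above (suc j) X
        ≤⟨ +-monoʳ-≤ (suc j ! * (n C ∣ X ∣)) (above-low i j X∈F ⊆-refl eq refl) ⟩
      suc j ! * (n C ∣ X ∣) + (suc j ! * (n C suc c) + j ! * (i * (n C c)))
        ≡⟨ collect j i (j !) (n C ∣ X ∣) (n C suc c) (n C c) ⟩
      j ! * (suc j * (n C ∣ X ∣) + i * (n C c)) + suc j ! * (n C suc c)
        -- Below level `c` the term of `X` itself is small enough to leave room for the extra `i`
        -- copies of `n C c`.
        ≤⟨ +-monoˡ-≤ (suc j ! * (n C suc c)) (*-monoʳ-≤ (j !) (+-monoˡ-≤ (i * (n C c))
             (scaled-C-increasing ∣ X ∣ i eq))) ⟩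
      j ! * (suc d * (n C c) + i * (n C c)) + suc j ! * (n C suc c)
        ≡⟨ regroup d i (j !) (n C suc c) (n C c) ⟩
      suc j ! * top ∎
      where
      collect : ∀ j i f w x y → suc j * f * w + (suc j * f * x + f * (i * y)) ≡
        f * (suc j * w + i * y) + suc j * f * x
      collect = solve-∀
      regroup : ∀ d i f x y → f * (suc d * y + i * y) + suc (d + i) * f * x ≡
        suc (d + i) * f * (y + x)
      regroup = solve-∀

    -- From level `c` upwards `n ≤ 2 c + 2` makes `weight-high` applicable, and its pair of adjacent
    -- levels is largest at `c`. Further down `weight-low` applies.
    weight-member : ∀ j {X} → X ∈ F → ∣ X ∣ + j ≡ n → weight j X ≤ j ! * top
    weight-member j {X} X∈F eq with ≤-total ∣ X ∣ c
    ... | inj₁ ∣X∣≤c = subst (λ j → weight j X ≤ j ! * top)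
      (+-cancelˡ-≡ ∣ X ∣ _ _ (trans (level-eq ∣ X ∣ i ∣X∣+i≡c) (sym eq)))
      (weight-low i (d + i) X∈F ∣X∣+i≡c refl)
      where
      i = c ∸ ∣ X ∣
      ∣X∣+i≡c = m+[n∸m]≡n ∣X∣≤c
    ... | inj₂ c≤∣X∣ = ≤-trans
      (weight-high j X∈F eq (+-cancelˡ-≤ ∣ X ∣ _ _ (begin
        ∣ X ∣ + j                 ≡⟨ eq ⟩
        n                         ≤⟨ n≤ ⟩
        c + suc (suc c)           ≤⟨ +-mono-≤ c≤∣X∣ (s≤s (s≤s c≤∣X∣)) ⟩
        ∣ X ∣ + suc (suc ∣ X ∣)   ∎)))
      (*-monoʳ-≤ (j !) (subst (λ k → (n C k) + (n C suc k) ≤ top) c+e≡∣X∣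
        (C-pair-decreasing c e j (trans (cong (_+ j) c+e≡∣X∣) eq) n≤)))
      where
      e = ∣ X ∣ ∸ c
      c+e≡∣X∣ = m+[n∸m]≡n c≤∣X∣
      n≤ : n ≤ c + suc (suc c)
      n≤ = ≤-trans (≤-reflexive (sym c+1+d≡n)) (+-monoʳ-≤ c (s≤s d≤1+c))

    -- A chain collects nothing before its first member of `F`, so the bound at members passes down
    -- to all sets by averaging over covers.
    weight≤ : ∀ j X → ∣ X ∣ + j ≡ n → weight j X ≤ j ! * top
    above≤ : ∀ j X → ∣ X ∣ + j ≡ n → above j X ≤ j ! * top

    above≤ zero    X eq = z≤n
    above≤ (suc j) X eq = ≤-trans
      (∑⋖-≤ X (suc j) eq λ {Y} X⋖Y → weight≤ j Y (⋖⇒∣∣+ X⋖Y eq))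
      (≤-reflexive (sym (*-assoc (suc j) (j !) top)))

    weight≤ j X eq = [ (λ X∈F → weight-member j X∈F eq)
                     , (λ X∉F → subst (_≤ j ! * top) (sym (weight-∉ j X∉F)) (above≤ j X eq))
                     ]′ (toSum (X ∈F?))

    ∑χ≤top : ∑ χ ≤ top
    ∑χ≤top = *-cancelˡ-≤ (n !) {{n !≢0}} (begin
      n ! * ∑ χ           ≡⟨ n!*∑χ≡total∅ ⟩
      total ∅             ≤⟨ weight≤ (n ∸ ∣ ∅ {n} ∣) ∅ (m+[n∸m]≡n (∣p∣≤n ∅)) ⟩
      (n ∸ ∣ ∅ {n} ∣) ! * top   ≡⟨ cong (λ k → (n ∸ k) ! * top) (∣⊥∣≡0 n) ⟩
      n ! * top           ∎)

-- The value of Σ n 2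

-- The filter keeps the entries at positions `c` and `c + 1`, and all other terms are nonnegative. A
-- general `f` is allowed because induction on `c` replaces it by `f ∘ suc`.
sum-filter-consecutive : ∀ {p} {P : Pred ℕ p} (P? : Decidable P) (g f : ℕ → ℕ) c {e m} →
  m ≡ c + suc (suc e) → P (f c) → P (f (suc c)) →
  g (f c) + g (f (suc c)) ≤ sum (map g (filter P? (applyUpTo f m)))
sum-filter-consecutive P? g f zero {e} refl P₀ P₁
  rewrite filter-accept P? {xs = applyUpTo (f ∘ suc) (suc e)} P₀
        | filter-accept P? {xs = applyUpTo (f ∘ suc ∘ suc) e} P₁
  = +-monoʳ-≤ (g (f 0)) (m≤m+n (g (f 1)) _)
sum-filter-consecutive P? g f (suc c) refl P₀ P₁ with does (P? (f 0))
... | inside  = ≤-trans (sum-filter-consecutive P? g (f ∘ suc) c refl P₀ P₁) (m≤n+m _ (g (f 0)))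
... | outside = sum-filter-consecutive P? g (f ∘ suc) c refl P₀ P₁

middle≤Σ : ∀ {n} c d → c + suc d ≡ n → c ≤ d → d ≤ suc c → (n C c) + (n C suc c) ≤ Σ n 2
middle≤Σ c d refl c≤d d≤1+c =
  sum-filter-consecutive (λ i → (n ≤? 2 * i + 2) ×-dec (2 * i <? n + 2)) (n C_) (λ i → i) c
    (sym (+-suc c (suc d)))
    ( (begin
        c + suc d           ≤⟨ +-monoʳ-≤ c (s≤s d≤1+c) ⟩
        c + suc (suc c)     ≡⟨ double c ⟩
        2 * c + 2           ∎)
    , (begin-strict
        2 * c               ≡⟨ cong (c +_) (+-identityʳ c) ⟩
        c + c               ≤⟨ +-monoʳ-≤ c (≤-trans c≤d (n≤1+n d)) ⟩
        c + suc d           <⟨ m<m+n (c + suc d) z<s ⟩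
        c + suc d + 2       ∎))
    ( (begin
        c + suc d           ≤⟨ +-monoʳ-≤ c (s≤s d≤1+c) ⟩
        c + suc (suc c)     ≡⟨ double c ⟩
        2 * c + 2           ≤⟨ +-monoˡ-≤ 2 (*-monoʳ-≤ 2 (n≤1+n c)) ⟩
        2 * suc c + 2       ∎)
    , (begin-strict
        2 * suc c           ≡⟨ double′ c ⟩
        c + suc c + 1       ≤⟨ +-monoˡ-≤ 1 (+-monoʳ-≤ c (s≤s c≤d)) ⟩
        c + suc d + 1       <⟨ +-monoʳ-< (c + suc d) (s<s z<s) ⟩
        c + suc d + 2       ∎))
  where
  n = c + suc d
  double : ∀ c → c + suc (suc c) ≡ 2 * c + 2
  double = solve-∀
  double′ : ∀ c → 2 * suc c ≡ c + suc c + 1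
  double′ = solve-∀

theorem2p18 : (n : ℕ) (F : List (Subset n)) → Unique F →
    (∀ A B C D → A ∈ F → B ∈ F → C ∈ F → D ∈ F →
    ¬ (A ⊂ B × B ⊂ D × A ⊂ C × ∣ B ∣ ≡ ∣ C ∣ × ¬ B ≡ C × ¬ C ≡ D)) →
    length F ≤ Σ n 2
-- For `n = 0` no `c` and `d` exist; there is one subset, and `Σ 0 2` computes to 1.
theorem2p18 zero    F unique free = ≤-trans (length≤∑χ unique) (Weight.χ≤1 F [])
theorem2p18 (suc m) F unique free = begin
  length F                          ≤⟨ length≤∑χ unique ⟩
  ∑ (Weight.χ F)                    ≤⟨ Bounds.Middle.∑χ≤top F free c d c+1+d≡n c≤d d≤1+c ⟩
  (suc m C c) + (suc m C suc c)     ≤⟨ middle≤Σ c d c+1+d≡n c≤d d≤1+c ⟩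
  Σ (suc m) 2                       ∎
  where
  c = ⌊ m /2⌋
  d = ⌈ m /2⌉
  c+1+d≡n : c + suc d ≡ suc m
  c+1+d≡n = trans (+-suc c d) (cong suc (⌊n/2⌋+⌈n/2⌉≡n m))
  c≤d = ⌊n/2⌋≤⌈n/2⌉ m
  d≤1+c : d ≤ suc c
  -- By definition `d` is `⌊ suc m /2⌋` and `suc c` is `⌊ suc (suc m) /2⌋`.
  d≤1+c = ⌊n/2⌋-mono (n≤1+n (suc m))
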